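{- Let $X = X_1\sqcup\dots\sqcup X_m$ and $Y = Y_1\sqcup\dots\sqcup Y_m$ be finite sets, partitioned into parts with $|X_k|\le|Y_k|$ for all $k\in[m]$. Let $\mathcal{S}$ be the set of injections $\sigma: X\to Y$ with $\sigma(X_k)\subset Y_k$ for all $k\in[m]$, and let $\Omega$ be the uniform probability space on $\mathcal{S}$. Let $B_i = \Omega(T_i,U_i,\tau_i)$, $i\in[N]$, be a family of canonical events in $\Omega$, and let $D$ be the graph on vertex set $[N]$ in which distinct $i,j$ are adjacent if and only if $B_i$ and $B_j$ $\mathcal{S}$-intersect. Then $D$ is a negative dependency graph for $B_1,\dots,B_N$.
   Context: For $T\subset X$, $U\subset Y$ and a bijection $\tau: T\to U$, the corresponding canonical event is $\Omega(T,U,\tau) = \{\sigma\in\mathcal{S}: \sigma(x) = \tau(x)\text{ for all }x\in T\}$; canonical events are understood together with their defining triple $(T,U,\tau)$. Two canonical events $\Omega(T_1,U_1,\tau_1)$ and $\Omega(T_2,U_2,\tau_2)$ $\mathcal{S}$-intersect if $T_1\cap T_2\ne\emptyset$ or $U_1\cap U_2\neq\emptyset$. A graph $D$ with vertex set $[N]$ is a negative dependency graph for events $B_1,\dots,B_N$ if for every $i\in[N]$ and every set $J\subset\{j: ij\notin E(D)\}$ it holds that $\mathbb{P}\left[B_i \mid \bigwedge_{j\in J}\overline{B_j}\right]\le\mathbb{P}[B_i]$, where the inequality is only required when the conditioning event has positive probability. -}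

module Defs where

open import Data.Bool using (true; false)
open import Data.Fin using (Fin; zero; suc; inject≤)
open import Data.Fin.Properties using (_≟_; all?; suc-injective; inject≤-injective)
open import Data.Fin.Subset using (Subset; _∈_; _∩_; ∣_∣; Nonempty)
open import Data.Fin.Subset.Properties using (_∈?_; ∩-comm)
open import Data.Integer using (+_)
open import Data.List using (List; []; _∷_; length; filter; allFin; cartesianProductWith)
import Data.List.Membership.Propositional as List
open import Data.List.Membership.Propositional.Properties
  using (∈-allFin; ∈-cartesianProductWith⁺; ∈-filter⁺; ∈-filter⁻; ∈-length)
open import Data.List.Relation.Unary.All using ([])
open import Data.List.Relation.Unary.AllPairs using ([]; _∷_)
open import Data.List.Relation.Unary.Any using (here)
open import Data.List.Relation.Unary.Unique.Propositional using (Unique)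
open import Data.List.Relation.Unary.Unique.Propositional.Properties
  using (allFin⁺; cartesianProductWith⁺; filter⁺)
open import Data.Nat using (ℕ; zero; suc; >-nonZero)
import Data.Nat as ℕ
open import Data.Product using (∃; _×_; _,_; proj₁; proj₂)
open import Data.Rational using (ℚ; 0ℚ; _/_; _÷_; _≤_; _<_)
import Data.Rational as ℚ
open import Data.Sum using (_⊎_; inj₁; inj₂)
open import Data.Vec using (Vec; []; _∷_; lookup; tabulate; here; there)
open import Data.Vec.Properties using (∷-injective; lookup∘tabulate)
open import Data.Vec.Properties.WithK using ([]=-irrelevant)
open import Function using (_∘_; _⇔_; mk⇔; _⤖_; Bijection; Injective)
open import Level using (0ℓ)
open import Relation.Binary using (Rel; Symmetric; Irreflexive)
open import Relation.Binary.PropositionalEquality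
  using (_≡_; _≢_; refl; sym; trans; cong; subst; subst₂)
open import Relation.Nullary using (¬_; Dec; yes; no; ¬?; contradiction)
open import Relation.Nullary.Decidable using (map′; _×-dec_; _→-dec_)
open import Relation.Unary using (Pred; Decidable)

record Event (A : Set) : Set₁ where
  field
    Holds  : Pred A 0ℓ
    holds? : Decidable Holds

open Event public

infixr 7 _∧ᵉ_

_∧ᵉ_ : ∀ {A} → Event A → Event A → Event A
(E ∧ᵉ F) .Holds ω  = Holds E ω × Holds F ω
(E ∧ᵉ F) .holds? ω = holds? E ω ×-dec holds? F ω

complement : ∀ {A} → Event A → Event A
complement E .Holds ω  = ¬ Holds E ω
complement E .holds? ω = ¬? (holds? E ω)

⋀[_] : ∀ {A N} → Subset N → (Fin N → Event A) → Event A
⋀[ J ] E .Holds ω  = ∀ j → j ∈ J → Holds (E j) ω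
⋀[ J ] E .holds? ω = all? λ j → (j ∈? J) →-dec holds? (E j) ω

-- The sample space is the set of entries of `outcomes`, which need not exhaust
-- the ambient type A.
record UniformSpace (A : Set) : Set where
  field
    outcomes : List A
    unique   : Unique outcomes
    nonempty : ℕ.NonZero (length outcomes)

module _ {A : Set} (Ω : UniformSpace A) where
  open UniformSpace Ω

  ℙ : Event A → ℚ
  ℙ E = _/_ (+ length (filter (holds? E) outcomes)) (length outcomes) {{nonempty}}

  ℙ[_∣_] : (E F : Event A) → 0ℚ < ℙ F → ℚ
  ℙ[ E ∣ F ] pos = _÷_ (ℙ (E ∧ᵉ F)) (ℙ F) {{ℚ.>-nonZero pos}}

record Graph (N : ℕ) : Set₁ where
  field
    Adj    : Rel (Fin N) 0ℓ
    symm   : Symmetric Adj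
    irrefl : Irreflexive _≡_ Adj

open Graph public

IsNegativeDependencyGraph :
  ∀ {A N} → UniformSpace A → (Fin N → Event A) → Graph N → Set
IsNegativeDependencyGraph {N = N} Ω B D =
  ∀ (i : Fin N) (J : Subset N) → (∀ j → j ∈ J → ¬ Adj D i j) →
  let C = ⋀[ J ] (complement ∘ B) in
  (pos : 0ℚ < ℙ Ω C) → ℙ[_∣_] Ω (B i) C pos ≤ ℙ Ω (B i)

-- Parts are allowed to be empty.
record Partition (n m : ℕ) : Set where
  field
    part     : Fin m → Subset n
    cover    : ∀ x → ∃ λ k → x ∈ part k
    disjoint : ∀ {x k l} → x ∈ part k → x ∈ part l → k ≡ l

open Partition public

-- A vector σ : Vec (Fin nY) nX stands for the map x ↦ lookup σ x.
PartRespectingInjection :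
  ∀ {nX nY m} → Partition nX m → Partition nY m → Pred (Vec (Fin nY) nX) 0ℓ
PartRespectingInjection 𝒳 𝒴 σ =
  Injective _≡_ _≡_ (lookup σ) ×
  (∀ k x → x ∈ part 𝒳 k → lookup σ x ∈ part 𝒴 k)

partRespectingInjection? :
  ∀ {nX nY m} (𝒳 : Partition nX m) (𝒴 : Partition nY m) →
  Decidable (PartRespectingInjection 𝒳 𝒴)
partRespectingInjection? 𝒳 𝒴 σ =
  map′ (λ inj {x} {y} → inj x y) (λ inj x y → inj {x} {y})
    (all? λ x → all? λ y → (lookup σ x ≟ lookup σ y) →-dec (x ≟ y))
  ×-dec
  (all? λ k → all? λ x → (x ∈? part 𝒳 k) →-dec (lookup σ x ∈? part 𝒴 k))

allVecs : ∀ k n → List (Vec (Fin k) n)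
allVecs k zero    = [] ∷ []
allVecs k (suc n) = cartesianProductWith _∷_ (allFin k) (allVecs k n)

∈-allVecs : ∀ {k n} (v : Vec (Fin k) n) → v List.∈ allVecs k n
∈-allVecs []      = here refl
∈-allVecs (x ∷ v) = ∈-cartesianProductWith⁺ _∷_ (∈-allFin x) (∈-allVecs v)

allVecs-unique : ∀ k n → Unique (allVecs k n)
allVecs-unique k zero    = [] ∷ []
allVecs-unique k (suc n) =
  cartesianProductWith⁺ _∷_ ∷-injective (allFin⁺ k) (allVecs-unique k n)

injections : ∀ {nX nY m} → Partition nX m → Partition nY m → List (Vec (Fin nY) nX)
injections {nX} {nY} 𝒳 𝒴 = filter (partRespectingInjection? 𝒳 𝒴) (allVecs nY nX)

∈-injections :
  ∀ {nX nY m} (𝒳 : Partition nX m) (𝒴 : Partition nY m) {σ : Vec (Fin nY) nX} →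
  σ List.∈ injections 𝒳 𝒴 ⇔ PartRespectingInjection 𝒳 𝒴 σ
∈-injections {nX} {nY} 𝒳 𝒴 {σ} = mk⇔
  (proj₂ ∘ ∈-filter⁻ (partRespectingInjection? 𝒳 𝒴) {xs = allVecs nY nX})
  (∈-filter⁺ (partRespectingInjection? 𝒳 𝒴) (∈-allVecs σ))

-- `rank` and `nth` number the elements of a subset in increasing order; they
-- are used only to see that the set of injections is nonempty.
rank : ∀ {n x} (P : Subset n) → x ∈ P → Fin ∣ P ∣
rank (true  ∷ P) here        = zero
rank (true  ∷ P) (there x∈P) = suc (rank P x∈P)
rank (false ∷ P) (there x∈P) = rank P x∈P

rank-injective : ∀ {n x y} (P : Subset n) (p : x ∈ P) (q : y ∈ P) →
                 rank P p ≡ rank P q → x ≡ y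
rank-injective (true  ∷ P) here      here      _  = refl
rank-injective (true  ∷ P) (there p) (there q) eq =
  cong suc (rank-injective P p q (suc-injective eq))
rank-injective (false ∷ P) (there p) (there q) eq = cong suc (rank-injective P p q eq)

nth : ∀ {n} (Q : Subset n) → Fin ∣ Q ∣ → Fin n
nth (true  ∷ Q) zero    = zero
nth (true  ∷ Q) (suc i) = suc (nth Q i)
nth (false ∷ Q) i       = suc (nth Q i)

nth-∈ : ∀ {n} (Q : Subset n) i → nth Q i ∈ Q
nth-∈ (true  ∷ Q) zero    = here
nth-∈ (true  ∷ Q) (suc i) = there (nth-∈ Q i)
nth-∈ (false ∷ Q) i       = there (nth-∈ Q i)

nth-injective : ∀ {n} (Q : Subset n) {i j} → nth Q i ≡ nth Q j → i ≡ j
nth-injective (true  ∷ Q) {zero}  {zero}  _  = refl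
nth-injective (true  ∷ Q) {suc i} {suc j} eq = cong suc (nth-injective Q (suc-injective eq))
nth-injective (false ∷ Q) eq = nth-injective Q (suc-injective eq)

module _ {nX nY m} (𝒳 : Partition nX m) (𝒴 : Partition nY m)
         (X≤Y : ∀ k → ∣ part 𝒳 k ∣ ℕ.≤ ∣ part 𝒴 k ∣) where

  private
    place : ∀ {x} k → x ∈ part 𝒳 k → Fin nY
    place k x∈k = nth (part 𝒴 k) (inject≤ (rank (part 𝒳 k) x∈k) (X≤Y k))

    place-∈ : ∀ {x} k (x∈k : x ∈ part 𝒳 k) → place k x∈k ∈ part 𝒴 k
    place-∈ k x∈k = nth-∈ (part 𝒴 k) _

    place-injective : ∀ {x y} k l (x∈k : x ∈ part 𝒳 k) (y∈l : y ∈ part 𝒳 l) →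
                      place k x∈k ≡ place l y∈l → x ≡ y
    place-injective k l x∈k y∈l eq
      with refl ← disjoint 𝒴 (place-∈ k x∈k) (subst (_∈ part 𝒴 l) (sym eq) (place-∈ l y∈l))
      = rank-injective (part 𝒳 k) x∈k y∈l
          (inject≤-injective (X≤Y k) (X≤Y k) _ _ (nth-injective (part 𝒴 k) eq))

    embed : Fin nX → Fin nY
    embed x = place (proj₁ (cover 𝒳 x)) (proj₂ (cover 𝒳 x))

    embed-∈ : ∀ k x → x ∈ part 𝒳 k → embed x ∈ part 𝒴 k
    embed-∈ k x x∈k = subst (λ l → embed x ∈ part 𝒴 l)
      (disjoint 𝒳 (proj₂ (cover 𝒳 x)) x∈k) (place-∈ _ (proj₂ (cover 𝒳 x)))

    tabulate-embed : PartRespectingInjection 𝒳 𝒴 (tabulate embed)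
    tabulate-embed =
      (λ {x} {y} eq → place-injective _ _ (proj₂ (cover 𝒳 x)) (proj₂ (cover 𝒳 y))
        (trans (sym (lookup∘tabulate embed x)) (trans eq (lookup∘tabulate embed y)))) ,
      (λ k x x∈k → subst (_∈ part 𝒴 k) (sym (lookup∘tabulate embed x)) (embed-∈ k x x∈k))

  injectionSpace : UniformSpace (Vec (Fin nY) nX)
  injectionSpace = record
    { outcomes = injections 𝒳 𝒴
    ; unique   = filter⁺ (partRespectingInjection? 𝒳 𝒴) (allVecs-unique nY nX)
    ; nonempty = >-nonZero (∈-length
        (∈-filter⁺ (partRespectingInjection? 𝒳 𝒴) (∈-allVecs (tabulate embed)) tabulate-embed))
    }

-- τ need not respect the parts; if it does not, the event is empty.
record CanonicalTriple (nX nY : ℕ) : Set where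
  field
    T : Subset nX
    U : Subset nY
    τ : ∃ (_∈ T) ⤖ ∃ (_∈ U)

  image : ∀ x → x ∈ T → Fin nY
  image x x∈T = proj₁ (Bijection.to τ (x , x∈T))

canonicalEvent : ∀ {nX nY} → CanonicalTriple nX nY → Event (Vec (Fin nY) nX)
canonicalEvent C .Holds σ = ∀ x (x∈T : x ∈ T) → lookup σ x ≡ image x x∈T
  where open CanonicalTriple C
canonicalEvent C .holds? σ = all? agrees?
  where
  open CanonicalTriple C
  agrees? : ∀ x → Dec (∀ (x∈T : x ∈ T) → lookup σ x ≡ image x x∈T)
  agrees? x with x ∈? T
  ... | no  x∉T = yes λ x∈T → contradiction x∈T x∉T
  ... | yes x∈T = map′
    (λ eq x∈T′ → trans eq (cong (image x) ([]=-irrelevant x∈T x∈T′)))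
    (λ eq → eq x∈T)
    (lookup σ x ≟ image x x∈T)

𝒮-Intersect : ∀ {nX nY} → Rel (CanonicalTriple nX nY) 0ℓ
𝒮-Intersect C₁ C₂ = Nonempty (T C₁ ∩ T C₂) ⊎ Nonempty (U C₁ ∩ U C₂)
  where open CanonicalTriple

intersectionGraph : ∀ {nX nY N} → (Fin N → CanonicalTriple nX nY) → Graph N
intersectionGraph B = record
  { Adj    = λ i j → i ≢ j × 𝒮-Intersect (B i) (B j)
  ; symm   = λ {i} {j} (i≢j , meet) → i≢j ∘ sym , flip-meet (B i) (B j) meet
  ; irrefl = λ i≡j (i≢j , _) → i≢j i≡j
  }
  where
  open CanonicalTriple
  flip-meet : ∀ C₁ C₂ → 𝒮-Intersect C₁ C₂ → 𝒮-Intersect C₂ C₁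
  flip-meet C₁ C₂ (inj₁ ne) = inj₁ (subst Nonempty (∩-comm (T C₁) (T C₂)) ne)
  flip-meet C₁ C₂ (inj₂ ne) = inj₂ (subst Nonempty (∩-comm (U C₁) (U C₂)) ne)

{-# OPTIONS --safe #-}

-- With B = B i and C the conditioning event, the claim is |B ∩ C| |𝒮| ≤ |C| |B|.
-- Given σ ∈ B ∩ C and ω ∈ 𝒮, there is a part-preserving permutation ρ of Y,
-- depending only on the restrictions of σ and ω to T = T i, with ρ ∘ σ = ω on T
-- and ρ fixing every point outside σ(T) ∪ ω(T).  Then (σ , ω) ↦ (ρ ∘ σ , ρ⁻¹ ∘ ω)
-- is the required injection into C × B.  It is injective since it exchanges the
-- restrictions to T, so ρ can be read off the image.  It preserves C since a
-- disjoint canonical event containing ρ ∘ σ only prescribes values fixed by ρ,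
-- and hence contains σ.

module Submission where

open import Defs
open import Data.Fin using (Fin; zero; suc)
open import Data.Fin.Permutation
  using (Permutation′; _⟨$⟩ʳ_; _⟨$⟩ˡ_; inverseˡ; inverseʳ; _∘ₚ_; transpose)
  renaming (id to idₚ)
import Data.Fin.Permutation.Components as PC
open import Data.Fin.Properties using (_≟_; injective⇒≤)
open import Data.Fin.Subset using (Subset; ∣_∣) renaming (_∈_ to _∈ˢ_)
open import Data.Fin.Subset.Properties using (_∈?_; x∈p∩q⁺)
open import Data.Integer as ℤ using (+_)
import Data.Integer.Properties as ℤ
open import Data.List using (List; []; _∷_; length; map; filter; lookup; allFin; cartesianProduct)
open import Data.List.Membership.Propositional using (_∈_)
open import Data.List.Membership.Propositional.Properties
  using (∈-lookup; ∈-allFin; ∈-filter⁺; ∈-filter⁻; ∈-cartesianProduct⁺; ∈-cartesianProduct⁻)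
open import Data.List.Properties using (length-map; length-++; map-cong-local)
import Data.List.Relation.Unary.All as All
open import Data.List.Relation.Unary.AllPairs using (_∷_)
open import Data.List.Relation.Unary.Any using (here; there; index)
open import Data.List.Relation.Unary.Any.Properties using (lookup-index)
open import Data.List.Relation.Unary.Unique.Propositional using (Unique)
open import Data.List.Relation.Unary.Unique.Propositional.Properties using (cartesianProduct⁺; filter⁺)
open import Data.Nat as ℕ using (ℕ; zero; suc; _≤_)
import Data.Nat.Properties as ℕ
open import Data.Product using (_×_; _,_; proj₁; proj₂)
import Data.Rational as ℚ
open ℚ using (0ℚ)
import Data.Rational.Properties as ℚ
import Data.Rational.Unnormalised as ℚᵘ
import Data.Rational.Unnormalised.Properties as ℚᵘ
open import Data.Sum using (inj₁; inj₂)
open import Data.Vec as Vec using (Vec)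
open import Data.Vec.Properties using (lookup-map; map-∘; map-id; map-cong)
open import Function using (_∘_; Injective; Bijection; Equivalence)
open import Relation.Binary.PropositionalEquality
open import Relation.Nullary using (¬_; yes; no; contradiction)

-- Comparing lengths of duplicate-free lists.

Unique⇒lookup-injective : ∀ {A : Set} {xs : List A} → Unique xs →
                          Injective _≡_ _≡_ (lookup xs)
Unique⇒lookup-injective (x∉xs ∷ u) {zero}  {zero}  _  = refl
Unique⇒lookup-injective (x∉xs ∷ u) {zero}  {suc j} eq =
  contradiction eq (All.lookup x∉xs (∈-lookup j))
Unique⇒lookup-injective (x∉xs ∷ u) {suc i} {zero}  eq =
  contradiction (sym eq) (All.lookup x∉xs (∈-lookup i))
Unique⇒lookup-injective (x∉xs ∷ u) {suc i} {suc j} eq =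
  cong suc (Unique⇒lookup-injective u eq)

-- Sending an index of `xs` to the position of its image in `ys` is injective, because `g` recovers
-- the entry. The left inverse is only required on entries of `xs`, so `f` may fail to be injective
-- elsewhere.
length-≤-by-retraction :
  ∀ {A B : Set} {xs : List A} {ys : List B} (f : A → B) (g : B → A) → Unique xs →
  (∀ {x} → x ∈ xs → f x ∈ ys) → (∀ {x} → x ∈ xs → g (f x) ≡ x) → length xs ≤ length ys
length-≤-by-retraction {xs = xs} {ys} f g u f∈ g∘f =
  injective⇒≤ {f = position} λ {i} {j} eq → Unique⇒lookup-injective u (begin
    lookup xs i                    ≡⟨ recover i ⟨
    g (lookup ys (position i))     ≡⟨ cong (g ∘ lookup ys) eq ⟩
    g (lookup ys (position j))     ≡⟨ recover j ⟩
    lookup xs j                    ∎)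
  where
  open ≡-Reasoning
  position : Fin (length xs) → Fin (length ys)
  position i = index (f∈ (∈-lookup i))
  recover : ∀ i → g (lookup ys (position i)) ≡ lookup xs i
  recover i = trans (cong g (sym (lookup-index (f∈ (∈-lookup i))))) (g∘f (∈-lookup i))

length-cartesianProduct : ∀ {A B : Set} (xs : List A) (ys : List B) →
                          length (cartesianProduct xs ys) ≡ length xs ℕ.* length ys
length-cartesianProduct []       ys = refl
length-cartesianProduct (x ∷ xs) ys =
  trans (length-++ (map (x ,_) ys))
        (cong₂ ℕ._+_ (length-map (x ,_) ys) (length-cartesianProduct xs ys))

-- From counts to conditional probabilities.

/-≤-/*/ : ∀ a b c n .{{_ : ℕ.NonZero n}} → a ℕ.* n ≤ b ℕ.* c →
          + a ℚ./ n ℚ.≤ (+ b ℚ./ n) ℚ.* (+ c ℚ./ n)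
/-≤-/*/ a b c n@(suc n-1) an≤bc = ℚ.toℚᵘ-cancel-≤ (begin
  ℚ.toℚᵘ (+ a ℚ./ n)                          ≃⟨ ℚ.toℚᵘ-fromℚᵘ (+ a ℚᵘ./ n) ⟩
  + a ℚᵘ./ n                                  ≤⟨ ℚᵘ.*≤* cross ⟩
  (+ b ℚᵘ./ n) ℚᵘ.* (+ c ℚᵘ./ n)
    ≃⟨ ℚᵘ.*-cong (ℚ.toℚᵘ-fromℚᵘ (+ b ℚᵘ./ n)) (ℚ.toℚᵘ-fromℚᵘ (+ c ℚᵘ./ n)) ⟨
  ℚ.toℚᵘ (+ b ℚ./ n) ℚᵘ.* ℚ.toℚᵘ (+ c ℚ./ n)  ≃⟨ ℚ.toℚᵘ-homo-* (+ b ℚ./ n) (+ c ℚ./ n) ⟨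
  ℚ.toℚᵘ ((+ b ℚ./ n) ℚ.* (+ c ℚ./ n))        ∎)
  where
  open ℚᵘ.≤-Reasoning
  -- Without normalisation the product has denominator `n * n`, so the cross-multiplied inequality
  -- is `an≤bc` times `n`.
  cross : + a ℤ.* + (n ℕ.* n) ℤ.≤ (+ b ℤ.* + c) ℤ.* + n
  cross = subst₂ ℤ._≤_
    (trans (cong +_ (ℕ.*-assoc a n n)) (ℤ.pos-* a (n ℕ.* n)))
    (trans (ℤ.pos-* (b ℕ.* c) n) (cong (ℤ._* + n) (ℤ.pos-* b c)))
    (ℤ.+≤+ (ℕ.*-monoˡ-≤ n an≤bc))

≤*⇒÷≤ : ∀ p q r .{{_ : ℚ.Positive q}} .{{_ : ℚ.NonZero q}} → p ℚ.≤ r ℚ.* q → p ℚ.÷ q ℚ.≤ r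
-- Exposing the positive numerator lets `1/ q` compute, so that its nonnegativity is found by
-- instance search.
≤*⇒÷≤ p q@(ℚ.mkℚ ℤ.+[1+ _ ] _ _) r p≤rq = begin
  p ℚ.* ℚ.1/ q            ≤⟨ ℚ.*-monoʳ-≤-nonNeg (ℚ.1/ q) p≤rq ⟩
  (r ℚ.* q) ℚ.* ℚ.1/ q    ≡⟨ ℚ.*-assoc r q (ℚ.1/ q) ⟩
  r ℚ.* (q ℚ.* ℚ.1/ q)    ≡⟨ cong (r ℚ.*_) (ℚ.*-inverseʳ q) ⟩
  r ℚ.* ℚ.1ℚ              ≡⟨ ℚ.*-identityʳ r ⟩
  r                       ∎
  where open ℚ.≤-Reasoning

module _ {A : Set} (Ω : UniformSpace A) where
  open UniformSpace Ω

  count : Event A → ℕ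
  count E = length (filter (holds? E) outcomes)

  conditional-≤ : ∀ (E F : Event A) →
                  count (E ∧ᵉ F) ℕ.* length outcomes ≤ count E ℕ.* count F →
                  (pos : 0ℚ ℚ.< ℙ Ω F) → ℙ[_∣_] Ω E F pos ℚ.≤ ℙ Ω E
  conditional-≤ E F counts pos =
    ≤*⇒÷≤ (ℙ Ω (E ∧ᵉ F)) (ℙ Ω F) (ℙ Ω E) {{ℚ.positive pos}} {{ℚ.>-nonZero pos}}
      (/-≤-/*/ (count (E ∧ᵉ F)) (count E) (count F) (length outcomes) {{nonempty}} counts)

-- A permutation carrying one injection to another on a list.

transpose-elim : ∀ {n} (Q : Fin n → Set) (i j k : Fin n) →
                 (k ≡ i → Q j) → (k ≡ j → Q i) → (k ≢ i → k ≢ j → Q k) →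
                 Q (PC.transpose i j k)
transpose-elim Q i j k at-i at-j else with k ≟ i
... | yes k≡i = at-i k≡i
... | no  k≢i with k ≟ j
...   | yes k≡j = at-j k≡j
...   | no  k≢j = else k≢i k≢j

-- The tail is aligned first; one transposition then moves the current image of `u` to `v`.
align : ∀ {n} → List (Fin n × Fin n) → Permutation′ n
align []             = idₚ
align ((u , v) ∷ ps) = align ps ∘ₚ transpose (align ps ⟨$⟩ʳ u) v

⟨$⟩ʳ-injective : ∀ {n} (ρ : Permutation′ n) {x y} → ρ ⟨$⟩ʳ x ≡ ρ ⟨$⟩ʳ y → x ≡ y
⟨$⟩ʳ-injective ρ eq = trans (sym (inverseˡ ρ)) (trans (cong (ρ ⟨$⟩ˡ_) eq) (inverseˡ ρ))

module _ {A : Set} {n : ℕ} (f g : A → Fin n) where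

  alignOn : List A → Permutation′ n
  alignOn L = align (map (λ x → f x , g x) L)

  -- The transposition for the head `y` can touch the value already reached at `x` only if
  -- `f x ≡ f y` or `g x ≡ g y`. Injectivity then gives `x ≡ y`, and the value is still right, so
  -- repeated entries in the list do no harm.
  alignOn-maps : Injective _≡_ _≡_ f → Injective _≡_ _≡_ g →
                 ∀ L {x} → x ∈ L → alignOn L ⟨$⟩ʳ f x ≡ g x
  alignOn-maps f-inj g-inj (x ∷ L) (here refl) =
    transpose-elim (_≡ g x) (ρ ⟨$⟩ʳ f x) (g x) (ρ ⟨$⟩ʳ f x)
      (λ _ → refl) (λ eq → eq) (λ ≢ _ → contradiction refl ≢)
    where ρ = alignOn L
  alignOn-maps f-inj g-inj (y ∷ L) {x} (there x∈L) =
    transpose-elim (_≡ g x) (ρ ⟨$⟩ʳ f y) (g y) (ρ ⟨$⟩ʳ f x)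
      (λ eq → cong g (sym (f-inj (⟨$⟩ʳ-injective ρ eq))))
      (λ eq → trans (cong (λ z → ρ ⟨$⟩ʳ f z) (sym (g-inj (trans (sym ih) eq)))) ih)
      (λ _ _ → ih)
    where
    ρ = alignOn L
    ih = alignOn-maps f-inj g-inj L x∈L

  alignOn-fixes : ∀ L {y} → (∀ {x} → x ∈ L → y ≢ f x × y ≢ g x) → alignOn L ⟨$⟩ʳ y ≡ y
  alignOn-fixes []      away = refl
  alignOn-fixes (x ∷ L) {y} away =
    transpose-elim (_≡ y) (ρ ⟨$⟩ʳ f x) (g x) (ρ ⟨$⟩ʳ y)
      (λ eq → contradiction (⟨$⟩ʳ-injective ρ eq) (proj₁ (away (here refl))))
      (λ eq → contradiction (trans (sym ih) eq) (proj₂ (away (here refl))))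
      (λ _ _ → ih)
    where
    ρ = alignOn L
    ih = alignOn-fixes L (away ∘ there)

  -- Every transposition used swaps two points of equal label: `ρ` keeps the label of `f x` by
  -- induction, and `g x` has that same label. For the theorem, `c` names the part of a point of
  -- `Y`.
  alignOn-preserves : ∀ {K : Set} (c : Fin n → K) L → (∀ x → c (f x) ≡ c (g x)) →
                      ∀ y → c (alignOn L ⟨$⟩ʳ y) ≡ c y
  alignOn-preserves c []      same y = refl
  alignOn-preserves c (x ∷ L) same y =
    transpose-elim (λ z → c z ≡ c y) (ρ ⟨$⟩ʳ f x) (g x) (ρ ⟨$⟩ʳ y)
      (λ eq → trans (sym c-swap) (trans (cong c (sym eq)) (ih y)))
      (λ eq → trans c-swap (trans (cong c (sym eq)) (ih y)))
      (λ _ _ → ih y)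
    where
    ρ = alignOn L
    ih = alignOn-preserves c L same
    c-swap : c (ρ ⟨$⟩ʳ f x) ≡ c (g x)
    c-swap = trans (ih (f x)) (same x)

-- The exchange map on pairs and its left inverse.

module _ {nX nY : ℕ} (L : List (Fin nX)) where

  aligner : Vec (Fin nY) nX → Vec (Fin nY) nX → Permutation′ nY
  aligner σ ω = alignOn (Vec.lookup σ) (Vec.lookup ω) L

  -- `unexchange` reverses the arguments of `aligner`: on `L`, the new first vector agrees with the
  -- old `ω` and the new second one with the old `σ`.
  exchange unexchange : Vec (Fin nY) nX × Vec (Fin nY) nX → Vec (Fin nY) nX × Vec (Fin nY) nX
  exchange   (σ , ω)   = Vec.map (aligner σ ω ⟨$⟩ʳ_) σ , Vec.map (aligner σ ω ⟨$⟩ˡ_) ω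
  unexchange (σ′ , ω′) = Vec.map (aligner ω′ σ′ ⟨$⟩ˡ_) σ′ , Vec.map (aligner ω′ σ′ ⟨$⟩ʳ_) ω′

  module _ (σ ω : Vec (Fin nY) nX)
           (σ-inj : Injective _≡_ _≡_ (Vec.lookup σ)) (ω-inj : Injective _≡_ _≡_ (Vec.lookup ω)) where
    private
      ρ  = aligner σ ω
      σ′ = proj₁ (exchange (σ , ω))
      ω′ = proj₂ (exchange (σ , ω))

    exchange₁-on : ∀ {x} → x ∈ L → Vec.lookup σ′ x ≡ Vec.lookup ω x
    exchange₁-on {x} x∈L =
      trans (lookup-map x (ρ ⟨$⟩ʳ_) σ) (alignOn-maps _ _ σ-inj ω-inj L x∈L)

    exchange₂-on : ∀ {x} → x ∈ L → Vec.lookup ω′ x ≡ Vec.lookup σ x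
    exchange₂-on {x} x∈L =
      trans (lookup-map x (ρ ⟨$⟩ˡ_) ω)
        (trans (cong (ρ ⟨$⟩ˡ_) (sym (alignOn-maps _ _ σ-inj ω-inj L x∈L))) (inverseˡ ρ))

    -- `align` sees only the pairs of values on `L`, and these are the same pairs before and after
    -- the exchange.
    aligner-exchange : aligner ω′ σ′ ≡ ρ
    aligner-exchange = cong align (map-cong-local
      (All.tabulate λ x∈L → cong₂ _,_ (exchange₂-on x∈L) (exchange₁-on x∈L)))

    unexchange-exchange : unexchange (exchange (σ , ω)) ≡ (σ , ω)
    unexchange-exchange = cong₂ _,_
      (trans (cong (λ π → Vec.map (π ⟨$⟩ˡ_) σ′) aligner-exchange)
             (undo (λ _ → inverseˡ ρ) σ))
      (trans (cong (λ π → Vec.map (π ⟨$⟩ʳ_) ω′) aligner-exchange)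
             (undo (λ _ → inverseʳ ρ) ω))
      where
      undo : ∀ {p q : Fin nY → Fin nY} → (∀ y → q (p y) ≡ y) →
             (v : Vec (Fin nY) nX) → Vec.map q (Vec.map p v) ≡ v
      undo {p} {q} qp v = trans (sym (map-∘ q p v)) (trans (map-cong qp v) (map-id v))

-- The exchange stays within part-respecting injections.

module _ {nX nY m : ℕ} (𝒳 : Partition nX m) (𝒴 : Partition nY m) where

  partOf : ∀ {n} → Partition n m → Fin n → Fin m
  partOf 𝒫 x = proj₁ (cover 𝒫 x)

  -- Rephrases respect for parts as an equation of labels, the form that `alignOn-preserves`
  -- consumes.
  respects-partOf : ∀ (σ : Vec (Fin nY) nX) → PartRespectingInjection 𝒳 𝒴 σ →
                    ∀ x → partOf 𝒴 (Vec.lookup σ x) ≡ partOf 𝒳 x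
  respects-partOf σ (_ , resp) x =
    disjoint 𝒴 (proj₂ (cover 𝒴 (Vec.lookup σ x))) (resp _ x (proj₂ (cover 𝒳 x)))

  map-respects : ∀ (σ : Vec (Fin nY) nX) (p : Fin nY → Fin nY) → Injective _≡_ _≡_ p →
                 (∀ y → partOf 𝒴 (p y) ≡ partOf 𝒴 y) →
                 PartRespectingInjection 𝒳 𝒴 σ → PartRespectingInjection 𝒳 𝒴 (Vec.map p σ)
  map-respects σ p p-inj p-pres σ∈𝒮@(σ-inj , _) =
    (λ {x} {y} eq → σ-inj (p-inj (trans (sym (lookup-map x p σ)) (trans eq (lookup-map y p σ))))) ,
    λ k x x∈k → subst₂ (λ y l → y ∈ˢ part 𝒴 l)
      (sym (lookup-map x p σ))
      (trans (p-pres (Vec.lookup σ x))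
        (trans (respects-partOf σ σ∈𝒮 x) (disjoint 𝒳 (proj₂ (cover 𝒳 x)) x∈k)))
      (proj₂ (cover 𝒴 (p (Vec.lookup σ x))))

  module _ (L : List (Fin nX)) (σ ω : Vec (Fin nY) nX)
           (σ∈𝒮 : PartRespectingInjection 𝒳 𝒴 σ) (ω∈𝒮 : PartRespectingInjection 𝒳 𝒴 ω) where
    private
      ρ = aligner L σ ω

      ρ-pres : ∀ y → partOf 𝒴 (ρ ⟨$⟩ʳ y) ≡ partOf 𝒴 y
      ρ-pres = alignOn-preserves _ _ (partOf 𝒴) L
        λ x → trans (respects-partOf σ σ∈𝒮 x) (sym (respects-partOf ω ω∈𝒮 x))

    exchange₁-respects : PartRespectingInjection 𝒳 𝒴 (proj₁ (exchange L (σ , ω)))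
    exchange₁-respects = map-respects σ (ρ ⟨$⟩ʳ_) (⟨$⟩ʳ-injective ρ) ρ-pres σ∈𝒮

    exchange₂-respects : PartRespectingInjection 𝒳 𝒴 (proj₂ (exchange L (σ , ω)))
    exchange₂-respects = map-respects ω (ρ ⟨$⟩ˡ_)
      (λ eq → trans (sym (inverseʳ ρ)) (trans (cong (ρ ⟨$⟩ʳ_) eq) (inverseʳ ρ)))
      (λ y → trans (sym (ρ-pres (ρ ⟨$⟩ˡ y))) (cong (partOf 𝒴) (inverseʳ ρ)))
      ω∈𝒮

-- Canonical events under the exchange, and the resulting count.

image-∈U : ∀ {nX nY} (C : CanonicalTriple nX nY) {x} (x∈T : x ∈ˢ CanonicalTriple.T C) →
           CanonicalTriple.image C x x∈T ∈ˢ CanonicalTriple.U C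
image-∈U C x∈T = proj₂ (Bijection.to (CanonicalTriple.τ C) (_ , x∈T))

module _ {nX nY m N : ℕ} (𝒳 : Partition nX m) (𝒴 : Partition nY m)
         (B : Fin N → CanonicalTriple nX nY) (i : Fin N) (J : Subset N)
         (J-apart : ∀ j → j ∈ˢ J → ¬ Adj (intersectionGraph B) i j) where
  open CanonicalTriple

  private
    L : List (Fin nX)
    L = filter (_∈? T (B i)) (allFin nX)

    ∈L⁺ : ∀ {x} → x ∈ˢ T (B i) → x ∈ L
    ∈L⁺ x∈T = ∈-filter⁺ (_∈? T (B i)) (∈-allFin _) x∈T

    ∈L⁻ : ∀ {x} → x ∈ L → x ∈ˢ T (B i)
    ∈L⁻ x∈L = proj₂ (∈-filter⁻ (_∈? T (B i)) {xs = allFin nX} x∈L)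

    Bᵢ C : Event (Vec (Fin nY) nX)
    Bᵢ = canonicalEvent (B i)
    C  = ⋀[ J ] (complement ∘ canonicalEvent ∘ B)

    S : List (Vec (Fin nY) nX)
    S = injections 𝒳 𝒴

  module _ (σ ω : Vec (Fin nY) nX)
           (σ∈𝒮 : PartRespectingInjection 𝒳 𝒴 σ) (ω∈𝒮 : PartRespectingInjection 𝒳 𝒴 ω)
           (σ∈Bᵢ : Holds Bᵢ σ) where
    private
      ρ  = aligner L σ ω
      σ′ = proj₁ (exchange L (σ , ω))

    exchange₂-∈Bᵢ : Holds Bᵢ (proj₂ (exchange L (σ , ω)))
    exchange₂-∈Bᵢ x x∈T =
      trans (exchange₂-on L σ ω (proj₁ σ∈𝒮) (proj₁ ω∈𝒮) (∈L⁺ x∈T)) (σ∈Bᵢ x x∈T)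

    exchange₁-reflects : ∀ j → ¬ 𝒮-Intersect (B i) (B j) →
                         Holds (canonicalEvent (B j)) σ′ → Holds (canonicalEvent (B j)) σ
    exchange₁-reflects j apart σ′∈Bⱼ x x∈Tⱼ =
      -- `ρ` sends both `σ x` and `y` to `y`, hence `σ x` is the prescribed value.
      ⟨$⟩ʳ-injective ρ (trans ρσx≡y (sym (alignOn-fixes _ _ L away)))
      where
      y = image (B j) x x∈Tⱼ

      ρσx≡y : ρ ⟨$⟩ʳ Vec.lookup σ x ≡ y
      ρσx≡y = trans (sym (lookup-map x (ρ ⟨$⟩ʳ_) σ)) (σ′∈Bⱼ x x∈Tⱼ)

      away : ∀ {t} → t ∈ L → y ≢ Vec.lookup σ t × y ≢ Vec.lookup ω t
      away {t} t∈L =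
        -- As `σ` lies in `Bᵢ`, its value at `t` belongs to `U (B i)`, so `y` would be common to
        -- both target sets.
        (λ y≡σt → apart (inj₂ (y , x∈p∩q⁺
          ( subst (_∈ˢ U (B i)) (sym (trans y≡σt (σ∈Bᵢ t (∈L⁻ t∈L)))) (image-∈U (B i) (∈L⁻ t∈L))
          , image-∈U (B j) x∈Tⱼ)))) ,
        -- On `L` the values of `ω` are those of `σ′`, so injectivity of `σ′` would give `t ≡ x`, a
        -- common point of both domains.
        (λ y≡ωt → apart (inj₁ (t , x∈p∩q⁺
          ( ∈L⁻ t∈L
          , subst (_∈ˢ T (B j))
              (proj₁ (exchange₁-respects 𝒳 𝒴 L σ ω σ∈𝒮 ω∈𝒮)
                (trans (σ′∈Bⱼ x x∈Tⱼ)
                  (trans y≡ωt (sym (exchange₁-on L σ ω (proj₁ σ∈𝒮) (proj₁ ω∈𝒮) t∈L)))))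
              x∈Tⱼ))))

    -- i itself may belong to J, since the graph has no loops.
    exchange₁-∈C : Holds C σ → Holds C σ′
    exchange₁-∈C σ∈C j j∈J with i ≟ j
    ... | yes refl = contradiction σ∈Bᵢ (σ∈C i j∈J)
    ... | no  i≢j  = σ∈C j j∈J ∘ exchange₁-reflects j (λ meet → J-apart j j∈J (i≢j , meet))

  -- Both products are lengths of cartesian products, and `exchange` maps the first list of pairs
  -- into the second with left inverse `unexchange`. The image has its factors in the order `C`,
  -- `Bᵢ`, hence the final commutation.
  exchange-count : length (filter (holds? (Bᵢ ∧ᵉ C)) S) ℕ.* length S
                   ≤ length (filter (holds? Bᵢ) S) ℕ.* length (filter (holds? C) S)
  exchange-count = subst₂ _≤_
    (length-cartesianProduct (filter (holds? (Bᵢ ∧ᵉ C)) S) S)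
    (trans (length-cartesianProduct (filter (holds? C) S) (filter (holds? Bᵢ) S))
           (ℕ.*-comm (length (filter (holds? C) S)) (length (filter (holds? Bᵢ) S))))
    (length-≤-by-retraction (exchange L) (unexchange L)
      (cartesianProduct⁺ (filter⁺ (holds? (Bᵢ ∧ᵉ C)) S-unique) S-unique)
      exchange-∈
      λ p∈ → let (σ∈𝒮 , _ , _) , ω∈𝒮 = split p∈ in
             unexchange-exchange L _ _ (proj₁ σ∈𝒮) (proj₁ ω∈𝒮))
    where
    S-unique : Unique S
    S-unique = filter⁺ (partRespectingInjection? 𝒳 𝒴) (allVecs-unique nY nX)

    open module ∈S {σ} = Equivalence (∈-injections 𝒳 𝒴 {σ}) renaming (to to ∈S⁻; from to ∈S⁺)

    split : ∀ {σ ω} → (σ , ω) ∈ cartesianProduct (filter (holds? (Bᵢ ∧ᵉ C)) S) S →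
            (PartRespectingInjection 𝒳 𝒴 σ × Holds Bᵢ σ × Holds C σ) × PartRespectingInjection 𝒳 𝒴 ω
    split p∈ =
      let σ∈ , ω∈S  = ∈-cartesianProduct⁻ (filter (holds? (Bᵢ ∧ᵉ C)) S) S p∈
          σ∈S , σ∈BC = ∈-filter⁻ (holds? (Bᵢ ∧ᵉ C)) {xs = S} σ∈
      in (∈S⁻ σ∈S , σ∈BC) , ∈S⁻ ω∈S

    exchange-∈ : ∀ {p} → p ∈ cartesianProduct (filter (holds? (Bᵢ ∧ᵉ C)) S) S →
                 exchange L p ∈ cartesianProduct (filter (holds? C) S) (filter (holds? Bᵢ) S)
    exchange-∈ {σ , ω} p∈ =
      let (σ∈𝒮 , σ∈Bᵢ , σ∈C) , ω∈𝒮 = split p∈ in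
      ∈-cartesianProduct⁺
        (∈-filter⁺ (holds? C) (∈S⁺ (exchange₁-respects 𝒳 𝒴 L σ ω σ∈𝒮 ω∈𝒮))
          (exchange₁-∈C σ ω σ∈𝒮 ω∈𝒮 σ∈Bᵢ σ∈C))
        (∈-filter⁺ (holds? Bᵢ) (∈S⁺ (exchange₂-respects 𝒳 𝒴 L σ ω σ∈𝒮 ω∈𝒮))
          (exchange₂-∈Bᵢ σ ω σ∈𝒮 ω∈𝒮 σ∈Bᵢ))

theorem2p2 : ∀ (nX nY m N : ℕ) (𝒳 : Partition nX m) (𝒴 : Partition nY m)
    (X≤Y : ∀ (k : Fin m) → ∣ part 𝒳 k ∣ ≤ ∣ part 𝒴 k ∣)
    (B : Fin N → CanonicalTriple nX nY) →
    IsNegativeDependencyGraph (injectionSpace 𝒳 𝒴 X≤Y) (canonicalEvent ∘ B) (intersectionGraph B)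
theorem2p2 nX nY m N 𝒳 𝒴 X≤Y B i J J-apart =
  let C = ⋀[ J ] (complement ∘ canonicalEvent ∘ B) in
  conditional-≤ (injectionSpace 𝒳 𝒴 X≤Y) (canonicalEvent (B i)) C
    (exchange-count 𝒳 𝒴 B i J J-apart)
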